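{- There is an algorithm which, given a finite graph $G$, computes an R-core of $G$ in time polynomial in the number of vertices of $G$.
   Context: Graphs are finite and undirected, with loops allowed: $G=(V_G,E_G)$ with $E_G\subseteq V_G\times V_G$ symmetric. A relation $R\subseteq X\times Y$ has full domain if every $x\in X$ is related to some $p\in Y$, and full image if every $p\in Y$ is related to by some $x\in X$. For a graph $G$, a finite set $B$ and a relation $R\subseteq V_G\times B$ with full image, $G\ast R$ is the graph with vertex set $B$ and edge set $\{(u,v)\in B\times B : \text{there is } (x,y)\in E_G \text{ with } (x,u),(y,v)\in R\}$. The equation $G\ast R=H$ means that $R\subseteq V_G\times V_H$ has full image and $G\ast R$ equals $H$ as a graph. Graphs $G,H$ are weakly relationally equivalent, $G\backsim_w H$, if there are relations $R\subseteq V_G\times V_H$ and $S\subseteq V_H\times V_G$, both with full domain, such that $G\ast R=H$ and $H\ast S=G$. A graph is an R-core if it has the smallest number of vertices among all graphs in its $\backsim_w$-equivalence class. $H$ is an R-core of $G$ if $H$ is an R-core and $H\backsim_w G$. -}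

module Defs where

open import Data.Fin using (Fin; toℕ)
open import Data.Fin.Properties using (any?)
open import Data.List using (List; []; _∷_; length; lookup; foldr; allFin; cartesianProductWith)
open import Data.Nat using (ℕ; zero; suc; _+_; _*_; _∸_; _≤_; _≟_)
open import Data.Product using (∃; ∃₂; _×_; _,_)
open import Data.Bool using (Bool; if_then_else_)
open import Function.Bundles using (_⇔_)
open import Level using (0ℓ)
open import Relation.Binary using (REL; Rel; Decidable; Symmetric)
open import Relation.Binary.PropositionalEquality using (_≡_; _≢_)
open import Relation.Nullary using (does; _×-dec_)

-- A graph with vertex set Fin n; loops are allowed.  Edge sets are subsets of
-- a finite set, hence decidable.

record Graph (n : ℕ) : Set₁ where
  field
    E     : Rel (Fin n) 0ℓ
    E?    : Decidable E
    E-sym : Symmetric E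

open Graph public

_≐_ : ∀ {n} → Graph n → Graph n → Set
G ≐ H = ∀ u v → E G u v ⇔ E H u v

-- A relation between finite sets, again as a decidable subset of the product.

record FinRel (m n : ℕ) : Set₁ where
  field
    Related  : REL (Fin m) (Fin n) 0ℓ
    Related? : Decidable Related

open FinRel public

FullDomain : ∀ {m n} → FinRel m n → Set
FullDomain R = ∀ x → ∃ λ p → Related R x p

FullImage : ∀ {m n} → FinRel m n → Set
FullImage R = ∀ p → ∃ λ x → Related R x p

_∗_ : ∀ {m n} → Graph m → FinRel m n → Graph n
E     (G ∗ R) u v = ∃₂ λ x y → E G x y × Related R x u × Related R y v
E?    (G ∗ R) u v = any? λ x → any? λ y →
                      E? G x y ×-dec Related? R x u ×-dec Related? R y v
E-sym (G ∗ R) (x , y , xy , xu , yv) = y , x , E-sym G xy , yv , xu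

_∗_≐ᶠ_ : ∀ {m n} → Graph m → FinRel m n → Graph n → Set
G ∗ R ≐ᶠ H = FullImage R × (G ∗ R) ≐ H

_∼w_ : ∀ {m n} → Graph m → Graph n → Set₁
_∼w_ {m} {n} G H =
  ∃ λ (R : FinRel m n) → ∃ λ (S : FinRel n m) →
    FullDomain R × FullDomain S × (G ∗ R ≐ᶠ H) × (H ∗ S ≐ᶠ G)

IsRCore : ∀ {m} → Graph m → Set₁
IsRCore {m} H = ∀ {k} (K : Graph k) → H ∼w K → m ≤ k

_IsRCoreOf_ : ∀ {m n} → Graph m → Graph n → Set₁
H IsRCoreOf G = IsRCore H × H ∼w G

-- Algorithms are structured programs for a random access machine: finitely
-- many named registers, an unbounded word-addressed memory, and unit cost per
-- instruction and per test.  The only arithmetic is addition and truncated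
-- subtraction, so after t steps every word has O(t + log n) bits on an input
-- whose words are at most n; polynomial time is therefore the same as on a
-- Turing machine (which unit-cost multiplication would break).

Reg : Set
Reg = ℕ

data Prog : Set where
  skip             : Prog
  _:=_             : Reg → ℕ → Prog
  _:=_+′_          : Reg → Reg → Reg → Prog
  _:=_∸′_          : Reg → Reg → Reg → Prog
  _:=mem[_]        : Reg → Reg → Prog
  mem[_]:=_        : Reg → Reg → Prog
  _⨾_              : Prog → Prog → Prog
  if≢0_then_else_  : Reg → Prog → Prog → Prog
  while≢0_loop_    : Reg → Prog → Prog

infixr 5 _⨾_

record State : Set where
  constructor ⟨_,_⟩
  field
    reg mem : ℕ → ℕ

open State public

_[_↦_] : (ℕ → ℕ) → ℕ → ℕ → (ℕ → ℕ)
(f [ i ↦ v ]) j = if does (j ≟ i) then v else f j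

setReg : State → Reg → ℕ → State
setReg s r v = ⟨ reg s [ r ↦ v ] , mem s ⟩

setMem : State → ℕ → ℕ → State
setMem s a v = ⟨ reg s , mem s [ a ↦ v ] ⟩

-- c ⊢ s ⇓[ t ] s′ : started in s, the program c halts in s′ after t steps.

data _⊢_⇓[_]_ : Prog → State → ℕ → State → Set where
  ⇓skip  : ∀ {s} → skip ⊢ s ⇓[ 1 ] s
  ⇓const : ∀ {s r k} → (r := k) ⊢ s ⇓[ 1 ] setReg s r k
  ⇓add   : ∀ {s r a b} → (r := a +′ b) ⊢ s ⇓[ 1 ] setReg s r (reg s a + reg s b)
  ⇓sub   : ∀ {s r a b} → (r := a ∸′ b) ⊢ s ⇓[ 1 ] setReg s r (reg s a ∸ reg s b)
  ⇓load  : ∀ {s r a} → (r :=mem[ a ]) ⊢ s ⇓[ 1 ] setReg s r (mem s (reg s a))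
  ⇓store : ∀ {s a r} → (mem[ a ]:= r) ⊢ s ⇓[ 1 ] setMem s (reg s a) (reg s r)
  ⇓seq   : ∀ {c d s s′ s″ t t′} →
           c ⊢ s ⇓[ t ] s′ → d ⊢ s′ ⇓[ t′ ] s″ → (c ⨾ d) ⊢ s ⇓[ t + t′ ] s″
  ⇓then  : ∀ {r c d s s′ t} → reg s r ≢ 0 →
           c ⊢ s ⇓[ t ] s′ → (if≢0 r then c else d) ⊢ s ⇓[ suc t ] s′
  ⇓else  : ∀ {r c d s s′ t} → reg s r ≡ 0 →
           d ⊢ s ⇓[ t ] s′ → (if≢0 r then c else d) ⊢ s ⇓[ suc t ] s′
  ⇓exit  : ∀ {r c s} → reg s r ≡ 0 → (while≢0 r loop c) ⊢ s ⇓[ 1 ] s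
  ⇓loop  : ∀ {r c s s′ s″ t t′} → reg s r ≢ 0 →
           c ⊢ s ⇓[ t ] s′ → (while≢0 r loop c) ⊢ s′ ⇓[ t′ ] s″ →
           (while≢0 r loop c) ⊢ s ⇓[ suc (t + t′) ] s″

bit : Bool → ℕ
bit b = if b then 1 else 0

-- The number of vertices followed by the adjacency matrix in row-major order.

encode : ∀ {n} → Graph n → List ℕ
encode {n} G =
  n ∷ cartesianProductWith (λ x y → bit (does (E? G x y))) (allFin n) (allFin n)

-- Input: the words of the list at addresses 0, 1, …, and 0 everywhere else.

load : List ℕ → ℕ → ℕ
load []       _       = 0
load (w ∷ ws) zero    = w
load (w ∷ ws) (suc a) = load ws a

initial : List ℕ → State
initial ws = ⟨ (λ _ → 0) , load ws ⟩

-- Output: memory starts with the given words; what lies beyond them is ignored.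

Outputs : State → List ℕ → Set
Outputs s ws = ∀ (i : Fin (length ws)) → mem s (toℕ i) ≡ lookup ws i

-- Polynomials over ℕ as coefficient lists, constant term first.

Poly : Set
Poly = List ℕ

eval : Poly → ℕ → ℕ
eval p n = foldr (λ a b → a + n * b) 0 p

{-# OPTIONS --safe #-}
-- Write N(x) for the neighbourhood of x.  A vertex x can be dropped when N(x) is
-- the union of a non-empty family of neighbourhoods of other vertices and is
-- contained in the neighbourhood of another vertex; a single pass over the
-- vertices dropping these one by one leaves a graph H ∼w G without such vertices.
-- Such an H is an R-core: if H ∼w K via R and S, put T = R ; S, so that
-- H ∗ T = H.  Some power F of T satisfies H = H F as Boolean matrices, hence x F y
-- implies N(x) ⊆ N(y).  Irreducibility forces F to be reflexive, and F factors
-- through K; two vertices factoring through the same vertex of K would have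
-- equal neighbourhoods, so H has at most as many vertices as K.
-- The test is a first-order formula, and these are evaluated in polynomial time.
module Submission where

open import Defs
open import Data.Bool using (Bool; true; false; if_then_else_) renaming (T to IsTrue)
open import Data.Bool.Properties using () renaming (T? to IsTrue?)
open import Data.Fin using (Fin; zero; suc; toℕ; fromℕ<; funToFin; finToFun; #_)
open import Data.Fin.Properties
  using (any?; pigeonhole; finToFun-funToFin; injective⇒≤; toℕ<n; toℕ-fromℕ<; toℕ-injective)
  renaming (_≟_ to _≟ᶠ_)
open import Data.List
  using (List; []; _∷_; [_]; _++_; _∷ʳ_; length; map; lookup; filter; take; tabulate; allFin; cartesianProductWith)
open import Data.List.Membership.Propositional using (_∈_)
open import Data.List.Membership.Propositional.Properties using (∈-filter⁺; ∈-filter⁻; ∈-allFin; ∈-lookup)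
open import Data.List.Properties
open import Data.List.Relation.Unary.All as All using ()
open import Data.List.Relation.Unary.AllPairs using (_∷_)
open import Data.List.Relation.Unary.Any using (index)
open import Data.List.Relation.Unary.Any.Properties using (lookup-index)
open import Data.List.Relation.Unary.Unique.Propositional using (Unique)
open import Data.List.Relation.Unary.Unique.Propositional.Properties using (filter⁺; allFin⁺)
open import Data.Nat using (ℕ; zero; suc; _+_; _*_; _∸_; _^_; _≤_; _<_; z≤n; s≤s; _≟_)
open import Data.Nat.Properties hiding (_≟_)
open import Data.Nat.Tactic.RingSolver using (solve-∀)
open import Data.Product using (∃; ∃₂; _×_; _,_; proj₁; proj₂)
open import Data.Sum using (_⊎_; inj₁; inj₂)
open import Data.Vec.Functional using (Vector; updateAt) renaming (_∷_ to _∷ᶠ_)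
open import Data.Vec.Functional.Properties using (updateAt-updates; updateAt-minimal)
open import Function using (_∘_; id; const)
open import Function.Bundles using (_⇔_; mk⇔; Equivalence)
open import Function.Definitions using (Injective)
open import Level using (0ℓ)
open import Relation.Binary using (Rel; Decidable)
open import Relation.Binary.PropositionalEquality
  using (_≡_; _≢_; refl; sym; trans; cong; cong₂; subst)
open import Relation.Nullary using (¬_; Dec; yes; no; does; ¬?; contradiction; decidable-stable; _×-dec_)
open import Relation.Nullary.Decidable using (map′; dec-true; dec-false)
open import Relation.Unary using (Pred)

open Equivalence using (to; from)

-- Generated vertices and weak relational equivalence

Dominated : ∀ {n} → Graph n → Rel (Fin n) 0ℓ
Dominated G x y = ∀ {v} → E G x v → E G y v

-- For A = {y ≠ x} this says that x can be dropped: N(x) is a union of a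
-- non-empty family of neighbourhoods of vertices in A, and is contained in one.
record Generated {n} (G : Graph n) (A : Pred (Fin n) 0ℓ) (x : Fin n) : Set where
  field
    above : ∃ λ p → A p × Dominated G x p
    below : ∃ λ y → A y × Dominated G y x
    cover : ∀ {v} → E G x v → ∃ λ y → A y × Dominated G y x × E G y v

open Generated

module _ {n} {G : Graph n} where

  generated-refl : ∀ {A : Pred (Fin n) 0ℓ} {x} → A x → Generated G A x
  generated-refl {x = x} Ax = record
    { above = x , Ax , id
    ; below = x , Ax , id
    ; cover = λ xv → x , Ax , id , xv
    }

  -- Domination is transitive, so witnesses compose. This keeps earlier removed vertices generated
  -- when one of their generators is removed later.
  generated-trans : ∀ {A B : Pred (Fin n) 0ℓ} → (∀ {x} → A x → Generated G B x) →
                    ∀ {x} → Generated G A x → Generated G B x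
  generated-trans A⇒B gx = record
    { above = let p , Ap , x⊑p = above gx ; q , Bq , p⊑q = above (A⇒B Ap)
              in q , Bq , λ xv → p⊑q (x⊑p xv)
    ; below = let p , Ap , p⊑x = below gx ; q , Bq , q⊑p = below (A⇒B Ap)
              in q , Bq , λ qv → p⊑x (q⊑p qv)
    ; cover = λ xv → let p , Ap , p⊑x , pv = cover gx xv
                         q , Bq , q⊑p , qv = cover (A⇒B Ap) pv
                     in q , Bq , (λ qw → p⊑x (q⊑p qw)) , qv
    }

  generated-mono : ∀ {A B : Pred (Fin n) 0ℓ} → (∀ {x} → A x → B x) →
                   ∀ {x} → Generated G A x → Generated G B x
  generated-mono A⊆B = generated-trans λ Ax → generated-refl (A⊆B Ax)

Image : ∀ {m n} → (Fin m → Fin n) → Pred (Fin n) 0ℓ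
Image ι x = ∃ λ i → ι i ≡ x

induced : ∀ {m n} → Graph n → (Fin m → Fin n) → Graph m
induced G ι = record
  { E     = λ i j → E G (ι i) (ι j)
  ; E?    = λ i j → E? G (ι i) (ι j)
  ; E-sym = E-sym G
  }

-- Decidability of `E` removes the double negation. The existential form is what `any?` decides and
-- what `dominatedᶠ` expresses.
dominated-¬∃ : ∀ {n} (G : Graph n) x y → (¬ ∃ λ v → E G x v × ¬ E G y v) ⇔ Dominated G x y
dominated-¬∃ G x y = mk⇔
  (λ none {v} xv → decidable-stable (E? G y v) λ ¬yv → none (v , xv , ¬yv))
  (λ { x⊑y (v , xv , ¬yv) → ¬yv (x⊑y xv) })

dominated? : ∀ {n} (G : Graph n) → Decidable (Dominated G)
dominated? G x y =
  map′ (to (dominated-¬∃ G x y)) (from (dominated-¬∃ G x y))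
       (¬? (any? λ v → E? G x v ×-dec ¬? (E? G y v)))

module _ {m n} {G : Graph n} {ι : Fin m → Fin n} (gen : ∀ x → Generated G (Image ι) x) where

  -- Both relations are restrictions of domination, which carries edges along at either end and so
  -- creates no new ones. `above` gives the full domain of the second relation, `below` the full
  -- image of the first, and `cover`, used once at each end, recovers every edge.
  induced∼w : induced G ι ∼w G
  induced∼w = record { Related = λ i x → Dominated G (ι i) x ; Related? = λ i x → dominated? G (ι i) x }
            , record { Related = λ x i → Dominated G x (ι i) ; Related? = λ x i → dominated? G x (ι i) }
            , (λ i → ι i , id)
            , above′
            , (below′ , λ u v → mk⇔ expand (cover′ u v))
            , ((λ i → ι i , id) , λ i j → mk⇔ expand λ ij → ι i , ι j , ij , id , id)
    where
    above′ : ∀ x → ∃ λ i → Dominated G x (ι i)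
    above′ x with above (gen x)
    ... | _ , (i , refl) , x⊑i = i , x⊑i

    below′ : ∀ x → ∃ λ i → Dominated G (ι i) x
    below′ x with below (gen x)
    ... | _ , (i , refl) , i⊑x = i , i⊑x

    expand : ∀ {I J : Set} {f : I → Fin n} {g : J → Fin n} {u v} →
             (∃₂ λ i j → E G (f i) (g j) × Dominated G (f i) u × Dominated G (g j) v) → E G u v
    expand (i , j , ij , i⊑u , j⊑v) = E-sym G (j⊑v (E-sym G (i⊑u ij)))

    cover′ : ∀ u v → E G u v →
             ∃₂ λ i j → E G (ι i) (ι j) × Dominated G (ι i) u × Dominated G (ι j) v
    cover′ u v uv with cover (gen u) uv
    ... | _ , (i , refl) , i⊑u , iv with cover (gen v) (E-sym G iv)
    ...   | _ , (j , refl) , j⊑v , ji = i , j , E-sym G ji , i⊑u , j⊑v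

  private
    -- Neighbourhoods in G are determined monotonically by their traces on the image.
    dominated-induced : ∀ {i j} → Dominated (induced G ι) i j → Dominated G (ι i) (ι j)
    dominated-induced i⊑j {v} iv with cover (gen v) (E-sym G iv)
    ... | _ , (k , refl) , k⊑v , ki = E-sym G (k⊑v (E-sym G (i⊑j (E-sym G ki))))

  -- A neighbour `v` of `ι i` may lie outside the image; it is then replaced by some `ι k` that it
  -- dominates, and the cover found for `k` also reaches `v`. Injectivity keeps the witnesses
  -- different from `ι i`.
  generated-induced : Injective _≡_ _≡_ ι → ∀ {i} → Generated (induced G ι) (_≢ i) i →
                      Generated G (λ y → Image ι y × y ≢ ι i) (ι i)
  generated-induced inj {i} gi = record
    { above = let j , j≢i , i⊑j = above gi in ι j , ((j , refl) , j≢i ∘ inj) , dominated-induced i⊑j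
    ; below = let j , j≢i , j⊑i = below gi in ι j , ((j , refl) , j≢i ∘ inj) , dominated-induced j⊑i
    ; cover = cover′
    }
    where
    cover′ : ∀ {v} → E G (ι i) v →
             ∃ λ y → (Image ι y × y ≢ ι i) × Dominated G y (ι i) × E G y v
    cover′ {v} iv with cover (gen v) (E-sym G iv)
    ... | _ , (k , refl) , k⊑v , ki =
      let j , j≢i , j⊑i , jk = cover gi (E-sym G ki)
      in ι j , ((j , refl) , j≢i ∘ inj) , dominated-induced j⊑i , E-sym G (k⊑v (E-sym G jk))

-- Irreducible graphs are R-cores

module Powers {n} (T : Rel (Fin n) 0ℓ) (T? : Decidable T) where

  -- Steps are split off on the left, so that `through` can read the first step of a power, and the
  -- vertex it passes, by pattern matching.
  Pow : ℕ → Rel (Fin n) 0ℓ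
  Pow zero    = _≡_
  Pow (suc k) x z = ∃ λ y → T x y × Pow k y z

  Pow? : ∀ k → Decidable (Pow k)
  Pow? zero    = _≟ᶠ_
  Pow? (suc k) x z = any? λ y → T? x y ×-dec Pow? k y z

  pow-+⁺ : ∀ k {l x y z} → Pow k x y → Pow l y z → Pow (k + l) x z
  pow-+⁺ zero    refl        yz = yz
  pow-+⁺ (suc k) (w , t , p) yz = w , t , pow-+⁺ k p yz

  pow-+⁻ : ∀ k {l x z} → Pow (k + l) x z → ∃ λ y → Pow k x y × Pow l y z
  pow-+⁻ zero    {x = x} p   = x , refl , p
  pow-+⁻ (suc k) (w , t , p) = let y , wy , yz = pow-+⁻ k p in y , (w , t , wy) , yz

  pow-total : (∀ x → ∃ (T x)) → ∀ k x → ∃ (Pow k x)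
  pow-total total zero    x = x , refl
  pow-total total (suc k) x =
    let y , t = total x ; z , p = pow-total total k y in z , y , t , p

  pow-surjective : (∀ z → ∃ λ x → T x z) → ∀ k z → ∃ λ x → Pow k x z
  pow-surjective surj zero    z = z , refl
  pow-surjective surj (suc k) z =
    let y , p = pow-surjective surj k z ; x , t = surj y in x , y , t , p

private
  indicator : ∀ {P : Set} → Dec P → Fin 2
  indicator p? = if does p? then suc zero else zero

  indicator-≡⇒ : ∀ {P Q : Set} (p? : Dec P) (q? : Dec Q) → indicator p? ≡ indicator q? → P → Q
  indicator-≡⇒ (yes _) (yes q) _  _ = q
  indicator-≡⇒ (yes _) (no _)  ()
  indicator-≡⇒ (no ¬p) _       _  p = contradiction p ¬p

  funToFin-injective : ∀ {m n} {f g : Fin m → Fin n} → funToFin f ≡ funToFin g → ∀ i → f i ≡ g i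
  funToFin-injective {f = f} {g} eq i =
    trans (sym (finToFun-funToFin f i)) (trans (cong (λ c → finToFun c i) eq) (finToFun-funToFin g i))

module _ {n} (M : ℕ → Rel (Fin n) 0ℓ) (M? : ∀ k → Decidable (M k)) where

  private
    code : ℕ → Fin ((2 ^ n) ^ n)
    code k = funToFin λ u → funToFin λ v → indicator (M? k u v)

    code-≡⇒ : ∀ {k l} → code k ≡ code l → ∀ {u v} → M k u v → M l u v
    code-≡⇒ {k} {l} eq {u} {v} =
      indicator-≡⇒ (M? k u v) (M? l u v) (funToFin-injective (funToFin-injective eq u) v)

  -- There are only `(2 ^ n) ^ n` Boolean matrices of this size, so the pigeonhole principle applies
  -- to their codes. The gap is a successor because a positive power is wanted.
  repetition : ∃₂ λ i d → ∀ {u v} → M i u v ⇔ M (i + suc d) u v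
  repetition =
    let i , j , i<j , eq = pigeonhole (n<1+n _) (λ i → code (toℕ i))
        d , i+d≡j = m≤n⇒∃[o]m+o≡n i<j
        eq′ = trans eq (cong code (sym (trans (+-suc (toℕ i) d) i+d≡j)))
    in toℕ i , d , mk⇔ (code-≡⇒ eq′) (code-≡⇒ (sym eq′))

-- If H ∗ T = H then H T^i = H T^(i+1+d) for some i and d, and multiplying by
-- the transpose of T^i on the left gives H = H T^(1+d).
module _ {n} {H : Graph n} {T : Rel (Fin n) 0ℓ} (T? : Decidable T) where

  open Powers T T?

  module _ (fixed : ∀ {u v} → E H u v ⇔ ∃₂ λ x y → E H x y × T x u × T y v) where

    private
      fixed-pow⁺ : ∀ k {u v} → E H u v → ∃₂ λ x y → E H x y × Pow k x u × Pow k y v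
      fixed-pow⁺ zero    uv = _ , _ , uv , refl , refl
      fixed-pow⁺ (suc k) uv =
        let x , y , xy , xu , yv = fixed-pow⁺ k uv
            a , b , ab , ax , by = to fixed xy
        in a , b , ab , (x , ax , xu) , (y , by , yv)

      fixed-pow⁻ : ∀ k {u v x y} → E H x y → Pow k x u → Pow k y v → E H u v
      fixed-pow⁻ zero    xy refl refl = xy
      fixed-pow⁻ (suc k) xy (_ , xx′ , x′u) (_ , yy′ , y′v) =
        fixed-pow⁻ k (from fixed (_ , _ , xy , xx′ , yy′)) x′u y′v

    one-sided : ∃ λ d → ∀ {u v} → E H u v ⇔ ∃ λ w → E H u w × Pow (suc d) w v
    one-sided = d , mk⇔ split join
      where
      M : ℕ → Rel (Fin n) 0ℓ
      M k x v = ∃ λ y → E H x y × Pow k y v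

      M? : ∀ k → Decidable (M k)
      M? k x v = any? λ y → E? H x y ×-dec Pow? k y v

      i = proj₁ (repetition M M?)
      d = proj₁ (proj₂ (repetition M M?))

      repeats : ∀ {u v} → M i u v ⇔ M (i + suc d) u v
      repeats = proj₂ (proj₂ (repetition M M?))

      split : ∀ {u v} → E H u v → ∃ λ w → E H u w × Pow (suc d) w v
      split uv =
        -- Both ends are pulled back along `Pow i`, the path to `v` is lengthened by the repetition,
        -- and `Pow i` is pushed forward again; the surplus `Pow (suc d)` remains on the right.
        let x , y , xy , xu , yv = fixed-pow⁺ i uv
            z , xz , zv = to repeats (y , xy , yv)
            w , zw , wv = pow-+⁻ i zv
        in w , fixed-pow⁻ i xz xu zw , wv

      join : ∀ {u v} → (∃ λ w → E H u w × Pow (suc d) w v) → E H u v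
      join (w , uw , wv) =
        let x , y , xy , xu , yw = fixed-pow⁺ i uw
            z , xz , zv = from repeats (y , xy , pow-+⁺ i yw wv)
        in fixed-pow⁻ i xz xu zv

-- Every vertex lies on an `F`-loop whose first step passes through a vertex of `K`; choosing one
-- such vertex for each `x` is injective.
irreducible⇒RCore : ∀ {m} {H : Graph m} → (∀ x → ¬ Generated H (_≢ x) x) → IsRCore H
irreducible⇒RCore {m} {H} irreducible {k} K (R , S , total-R , total-S , (onto-R , HR≐K) , (onto-S , KS≐H)) =
  injective⇒≤ {f = λ x → proj₁ (through x)} through-injective
  where
  T : Rel (Fin m) 0ℓ
  T x z = ∃ λ p → Related R x p × Related S p z

  T? : Decidable T
  T? x z = any? λ p → Related? R x p ×-dec Related? S p z

  open Powers T T?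

  fixed : ∀ {u v} → E H u v ⇔ ∃₂ λ x y → E H x y × T x u × T y v
  fixed {u} {v} = mk⇔
    (λ uv → let p , q , pq , pu , qv = from (KS≐H u v) uv
                x , y , xy , xp , yq = from (HR≐K p q) pq
            in x , y , xy , (p , xp , pu) , (q , yq , qv))
    (λ { (x , y , xy , (p , xp , pu) , (q , yq , qv)) →
         to (KS≐H u v) (p , q , to (HR≐K p q) (x , y , xy , xp , yq) , pu , qv) })

  d = proj₁ (one-sided {H = H} T? fixed)

  F : Rel (Fin m) 0ℓ
  F = Pow (suc d)

  H≐HF : ∀ {u v} → E H u v ⇔ ∃ λ w → E H u w × F w v
  H≐HF = proj₂ (one-sided {H = H} T? fixed)

  F⇒dominated : ∀ {x y} → F x y → Dominated H x y
  F⇒dominated xy xv = E-sym H (from H≐HF (_ , E-sym H xv , xy))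

  F-total : ∀ x → ∃ (F x)
  F-total = pow-total (λ x → let p , xp = total-R x ; z , pz = total-S p in z , p , xp , pz) (suc d)

  F-surjective : ∀ z → ∃ λ x → F x z
  F-surjective =
    pow-surjective (λ z → let p , pz = onto-S z ; x , xp = onto-R p in x , p , xp , pz) (suc d)

  F-refl : ∀ x → F x x
  -- If `x` were not `F`-related to itself, the witnesses from totality, surjectivity and `H≐HF`
  -- would all differ from `x`, and together they would generate it.
  F-refl x = decidable-stable (Pow? (suc d) x x) λ ¬xx → irreducible x record
    { above = let p , xp = F-total x in
              p , (λ p≡x → ¬xx (subst (F x) p≡x xp)) , F⇒dominated xp
    ; below = let y , yx = F-surjective x in
              y , (λ y≡x → ¬xx (subst (λ z → F z x) y≡x yx)) , F⇒dominated yx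
    ; cover = λ xv → let y , vy , yx = to H≐HF (E-sym H xv) in
              y , (λ y≡x → ¬xx (subst (λ z → F z x) y≡x yx)) , F⇒dominated yx , E-sym H vy
    }

  through : ∀ x → ∃ λ p → Related R x p × ∃ λ w → Related S p w × Pow d w x
  through x = let w , (p , xp , pw) , wx = F-refl x in p , xp , w , pw , wx

  -- The start of the loop at `x` and the rest of the loop at `y` meet at the common vertex of `K`
  -- and are spliced there.
  through⇒F : ∀ {x y} → proj₁ (through x) ≡ proj₁ (through y) → F x y
  through⇒F {x} {y} eq =
    let p , xp , _ = through x ; q , _ , w , qw , wy = through y
    in w , (q , subst (Related R x) eq xp , qw) , wy

  -- Splicing in both directions gives `x` and `y` equal neighbourhoods, so if they were distinct,
  -- `y` alone would generate `x`.
  through-injective : Injective _≡_ _≡_ λ x → proj₁ (through x)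
  through-injective {x} {y} eq = decidable-stable (x ≟ᶠ y) λ x≢y →
    let x⊑y = F⇒dominated (through⇒F eq) ; y⊑x = F⇒dominated (through⇒F (sym eq)) ; y≢x = x≢y ∘ sym
    in irreducible x record
      { above = y , y≢x , x⊑y
      ; below = y , y≢x , y⊑x
      ; cover = λ xv → y , y≢x , y⊑x , x⊑y xv
      }

-- Running programs

update-≡ : ∀ f {i j v} → j ≡ i → (f [ i ↦ v ]) j ≡ v
update-≡ f {i} {j} {v} j≡i = cong (if_then v else f j) (dec-true (j ≟ i) j≡i)

update-≢ : ∀ f {i j v} → j ≢ i → (f [ i ↦ v ]) j ≡ f j
update-≢ f {i} {j} {v} j≢i = cong (if_then v else f j) (dec-false (j ≟ i) j≢i)

-- A Hoare triple for total correctness with a step bound, so that correctness and running time are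
-- composed together.
record Halts (c : Prog) (s : State) (t : ℕ) (Q : State → Set) : Set where
  constructor halted
  field
    {end}   : State
    {steps} : ℕ
    run     : c ⊢ s ⇓[ steps ] end
    bound   : steps ≤ t
    post    : Q end

module _ {Q : State → Set} where

  within : ∀ {c s t t′} → t ≤ t′ → Halts c s t Q → Halts c s t′ Q
  within t≤t′ (halted r b q) = halted r (≤-trans b t≤t′) q

  weaken : ∀ {P : State → Set} {c s t} → Halts c s t P → (∀ {s′} → P s′ → Q s′) → Halts c s t Q
  weaken (halted r b p) P⇒Q = halted r b (P⇒Q p)

  last : ∀ {c s s′} → c ⊢ s ⇓[ 1 ] s′ → Q s′ → Halts c s 1 Q
  last r q = halted r ≤-refl q

  first : ∀ {c d s s′ t} → c ⊢ s ⇓[ 1 ] s′ → Halts d s′ t Q → Halts (c ⨾ d) s (1 + t) Q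
  first r (halted r′ b q) = halted (⇓seq r r′) (s≤s b) q

  infixr 5 _⨟_

  _⨟_ : ∀ {P : State → Set} {c d s t t′} → Halts c s t P →
        (∀ {s′} → P s′ → Halts d s′ t′ Q) → Halts (c ⨾ d) s (t + t′) Q
  halted r b p ⨟ k with k p
  ... | halted r′ b′ q = halted (⇓seq r r′) (+-mono-≤ b b′) q

  branch : ∀ {r c d s t} → (reg s r ≢ 0 → Halts c s t Q) → (reg s r ≡ 0 → Halts d s t Q) →
           Halts (if≢0 r then c else d) s (suc t) Q
  branch {r} {s = s} yes′ no′ with reg s r ≟ 0
  ... | no ≢0 = let halted r b q = yes′ ≢0 in halted (⇓then ≢0 r) (s≤s b) q
  ... | yes ≡0 = let halted r b q = no′ ≡0 in halted (⇓else ≡0 r) (s≤s b) q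

module _ {r : Reg} {c : Prog} {t : ℕ} (I : ℕ → State → Set)
         (counts : ∀ {k s} → I k s → reg s r ≡ k)
         (body : ∀ {k s} → I (suc k) s → Halts c s t (I k)) where

  -- The invariant is indexed by the iterations left, which the loop register holds. Each round
  -- costs its body and one test; leaving costs one more test.
  countdown : ∀ k {s} → I k s → Halts (while≢0 r loop c) s (1 + k * suc t) (I 0)
  countdown zero    i = halted (⇓exit (counts i)) ≤-refl i
  countdown (suc k) i with body i
  ... | halted r₁ b₁ i₁ with countdown k i₁
  ...   | halted r₂ b₂ i₂ = halted
    (⇓loop (λ r≡0 → 1+n≢0 (trans (sym (counts i)) r≡0)) r₁ r₂)
    (s≤s (≤-trans (+-mono-≤ b₁ b₂) (≤-reflexive (+-suc t (k * suc t)))))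
    i₂

-- The frame condition of expression code: registers from `r` on are scratch, and memory is only
-- read.
record Preserves (r : Reg) (s s′ : State) : Set where
  constructor preserves
  field
    same-mem : mem s′ ≡ mem s
    same-reg : ∀ {j} → j < r → reg s′ j ≡ reg s j

open Preserves

preserves-refl : ∀ {r s} → Preserves r s s
preserves-refl = preserves refl λ _ → refl

preserves-trans : ∀ {r s s′ s″} → Preserves r s s′ → Preserves r s′ s″ → Preserves r s s″
preserves-trans (preserves m p) (preserves m′ p′) =
  preserves (trans m′ m) λ j<r → trans (p′ j<r) (p j<r)

preserves-≤ : ∀ {q r s s′} → q ≤ r → Preserves r s s′ → Preserves q s s′
preserves-≤ q≤r (preserves m p) = preserves m λ j<q → p (≤-trans j<q q≤r)

preserves-set : ∀ {r r′ s v} → r ≤ r′ → Preserves r s (setReg s r′ v)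
preserves-set {s = s} r≤r′ = preserves refl λ j<r → update-≢ (reg s) (<⇒≢ (≤-trans j<r r≤r′))

infixl 4 _▹_

_▹_ : ∀ {r r′ s s′ v} → Preserves r s s′ → r ≤ r′ → Preserves r s (setReg s′ r′ v)
p ▹ r≤r′ = preserves-trans p (preserves-set r≤r′)

-- Register 0 holds the number n of vertices and register 1 the constant 1.

multiply : Reg → Prog
multiply r = while≢0 suc r loop ((r := r +′ 0) ⨾ (suc r := suc r ∸′ 1))

module _ {n : ℕ} where

  -- Multiplication is repeated addition; the accumulator plus the amount still to be added stays
  -- constant. Writing `r` as `2 + d` protects registers 0 and 1.
  multiply-correct : ∀ d {s k} → let r = 2 + d in
    reg s 0 ≡ n → reg s 1 ≡ 1 → reg s (suc r) ≡ k →
    Halts (multiply r) s (1 + k * 3) λ s′ → Preserves r s s′ × reg s′ r ≡ reg s r + k * n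
  multiply-correct d {s} {k} s0 s1 sk
    with countdown I (λ (sk , _) → sk) body k {s} (sk , preserves-refl , refl)
    where
    r = 2 + d

    I : ℕ → State → Set
    I j s′ = reg s′ (suc r) ≡ j × Preserves r s s′ × reg s′ r + j * n ≡ reg s r + k * n

    body : ∀ {j s′} → I (suc j) s′ → Halts ((r := r +′ 0) ⨾ (suc r := suc r ∸′ 1)) s′ 2 (I j)
    body {j} {s′} (sj , p , acc) = first ⇓add (last ⇓sub
      ( trans (update-≡ (reg s₁) {suc r} refl)
          (cong₂ _∸_ (trans (update-≢ (reg s′) {r} {suc r} (>⇒≢ ≤-refl)) sj) (trans (same-reg p (s≤s (s≤s z≤n))) s1))
      , (p ▹ ≤-refl ▹ n≤1+n _)
      , trans (cong (_+ j * n) (trans (update-≢ (reg s₁) {suc r} {r} (<⇒≢ ≤-refl)) (update-≡ (reg s′) {r} refl)))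
          (trans (cong (λ v → reg s′ r + v + j * n) (trans (same-reg p (s≤s z≤n)) s0))
            (trans (+-assoc (reg s′ r) n (j * n)) acc)) ))
      where s₁ = setReg s′ r (reg s′ r + reg s′ 0)

  ... | halted r b (_ , p , acc) = halted r b (p , trans (sym (+-identityʳ _)) acc)

-- Adding the zeroed `r` copies `a` into the loop counter. The final increment skips word 0, which
-- precedes the matrix in the encoding.
readEdge : Reg → Reg → Reg → Prog
readEdge a b r =
  (r := 0) ⨾ (suc r := a +′ r) ⨾ multiply r ⨾ (r := r +′ b) ⨾ (r := r +′ 1) ⨾ (r :=mem[ r ])

readEdge-correct : ∀ {n i j a b} d {s} → let r = 2 + d in
  reg s 0 ≡ n → reg s 1 ≡ 1 → a < r → b < r → reg s a ≡ i → reg s b ≡ j →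
  Halts (readEdge a b r) s (6 + i * 3) λ s′ →
    Preserves r s s′ × reg s′ r ≡ mem s (suc (i * n + j))
readEdge-correct {n} {i} {j} {a} {b} d {s} s0 s1 a<r b<r sa sb =
  within (≤-reflexive (arith (i * 3)))
    (first ⇓const (first ⇓add (multiply-correct d {k = i} s0 s1 counter ⨟ λ {s′} (p , acc) →
      let p₁ = preserves-trans (preserves-refl ▹ ≤-refl ▹ n≤1+n r) p
          s₃ = setReg s′ r (reg s′ r + reg s′ b)
          s₄ = setReg s₃ r (reg s₃ r + reg s₃ 1)
      in first ⇓add (first ⇓add (last ⇓load
           ( (p₁ ▹ ≤-refl ▹ ≤-refl ▹ ≤-refl)
           , trans (update-≡ (reg s₄) {r} refl)
               (trans (cong (mem s′) (address s′ p₁ acc)) (cong (λ m → m (suc (i * n + j))) (same-mem p₁))) ))))))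
  where
  r = 2 + d
  s₁ = setReg s r 0
  s₂ = setReg s₁ (suc r) (reg s₁ a + reg s₁ r)

  arith : ∀ x → 2 + ((1 + x) + 3) ≡ 6 + x
  arith = solve-∀

  counter : reg s₂ (suc r) ≡ i
  counter = trans (update-≡ (reg s₁) {suc r} refl)
    (trans (cong₂ _+_ (trans (update-≢ (reg s) (<⇒≢ a<r)) sa) (update-≡ (reg s) {r} refl)) (+-identityʳ i))

  address : ∀ s′ → Preserves r s s′ → reg s′ r ≡ reg s₂ r + i * n →
            let s₃ = setReg s′ r (reg s′ r + reg s′ b) in
            reg (setReg s₃ r (reg s₃ r + reg s₃ 1)) r ≡ suc (i * n + j)
  address s′ p acc =
    trans (update-≡ (reg (setReg s′ r (reg s′ r + reg s′ b))) {r} refl)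
      (trans (cong₂ _+_ (trans (update-≡ (reg s′) {r} refl) (cong₂ _+_ product (trans (same-reg p b<r) sb)))
                        (trans (same-reg p (s≤s (s≤s z≤n))) s1))
        (+-comm _ 1))
    where
    product : reg s′ r ≡ i * n
    product = trans acc (cong (_+ i * n)
      (trans (update-≢ (reg s₁) {suc r} {r} (<⇒≢ ≤-refl)) (update-≡ (reg s) {r} refl)))

-- Polynomials

infixl 6 _⊞_

_⊞_ : Poly → Poly → Poly
[]      ⊞ q       = q
(a ∷ p) ⊞ []      = a ∷ p
(a ∷ p) ⊞ (b ∷ q) = a + b ∷ p ⊞ q

eval-⊞ : ∀ p q n → eval (p ⊞ q) n ≡ eval p n + eval q n
eval-⊞ []      q       n = refl
eval-⊞ (a ∷ p) []      n = sym (+-identityʳ _)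
eval-⊞ (a ∷ p) (b ∷ q) n = trans (cong (λ e → a + b + n * e) (eval-⊞ p q n)) (arith a b n _ _)
  where
  arith : ∀ a b n x y → a + b + n * (x + y) ≡ a + n * x + (b + n * y)
  arith = solve-∀

eval-const-⊞ : ∀ k p n → eval ([ k ] ⊞ p) n ≡ k + eval p n
eval-const-⊞ k p n =
  trans (eval-⊞ [ k ] p n) (cong (_+ eval p n) (trans (cong (k +_) (*-zeroʳ n)) (+-identityʳ k)))

-- First-order formulas over marked graphs and their evaluation

-- Variables are de Bruijn indices. Universal quantifiers are expressed by `not` and `some`, so a
-- single search loop handles all quantification.
data Formula (k : ℕ) : Set where
  edge : Fin k → Fin k → Formula k
  dead : Fin k → Formula k
  not  : Formula k → Formula k
  _and_ : Formula k → Formula k → Formula k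
  some : Formula (suc k) → Formula k

infixr 6 _and_

module _ {n} (G : Graph n) (D : Fin n → Bool) where

  ⟦_⟧ : ∀ {k} → Formula k → Vector (Fin n) k → Set
  ⟦ edge i j ⟧ e = E G (e i) (e j)
  ⟦ dead i ⟧   e = IsTrue (D (e i))
  ⟦ not φ ⟧    e = ¬ ⟦ φ ⟧ e
  ⟦ φ and ψ ⟧  e = ⟦ φ ⟧ e × ⟦ ψ ⟧ e
  ⟦ some φ ⟧   e = ∃ λ x → ⟦ φ ⟧ (x ∷ᶠ e)

  ⟦_⟧? : ∀ {k} (φ : Formula k) e → Dec (⟦ φ ⟧ e)
  ⟦ edge i j ⟧? e = E? G (e i) (e j)
  ⟦ dead i ⟧?   e = IsTrue? (D (e i))
  ⟦ not φ ⟧?    e = ¬? (⟦ φ ⟧? e)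
  ⟦ φ and ψ ⟧?  e = ⟦ φ ⟧? e ×-dec ⟦ ψ ⟧? e
  ⟦ some φ ⟧?   e = any? λ x → ⟦ φ ⟧? (x ∷ᶠ e)

-- The result goes to register r and all registers from r on are scratch space.
compile : ∀ {k} → Formula k → Vector Reg k → Reg → Prog
compile (edge i j) ρ r = readEdge (ρ i) (ρ j) r
compile (dead i)   ρ r = (r := 2 +′ ρ i) ⨾ (r :=mem[ r ])
compile (not φ)    ρ r = compile φ ρ r ⨾ (r := 1 ∸′ r)
compile (φ and ψ)  ρ r = compile φ ρ r ⨾ (if≢0 r then compile ψ ρ r else skip)
compile (some φ)   ρ r =
  (r := 0) ⨾ (suc r := 0 +′ r) ⨾
  (while≢0 suc r loop
    ((suc r := suc r ∸′ 1) ⨾ compile φ (suc r ∷ᶠ ρ) (2 + r) ⨾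
     (if≢0 (2 + r) then (r := 1) else skip)))

-- Prefixing a coefficient multiplies the tail by `n`, so each quantifier raises the degree by one.
-- For `some`, 3 counts the two assignments and the exit test, and 4 the loop test, the decrement
-- and the branch with its body.
cost : ∀ {k} → Formula k → Poly
cost (edge i j) = 6 ∷ 3 ∷ []
cost (dead i)   = [ 2 ]
cost (not φ)    = [ 1 ] ⊞ cost φ
cost (φ and ψ)  = [ 2 ] ⊞ cost φ ⊞ cost ψ
cost (some φ)   = 3 ∷ [ 4 ] ⊞ cost φ

-- Truth values are exactly 0 and 1, so that `1 ∸ v` negates and a verdict can be stored directly as
-- a mark.
Decides : ℕ → Set → Set
Decides v P = (v ≡ 1 × P) ⊎ (v ≡ 0 × ¬ P)

decides-bit : ∀ {P : Set} (p? : Dec P) → Decides (bit (does p?)) P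
decides-bit (yes p) = inj₁ (refl , p)
decides-bit (no ¬p) = inj₂ (refl , ¬p)

decides-map : ∀ {v} {P Q : Set} → (P → Q) → (Q → P) → Decides v P → Decides v Q
decides-map f g (inj₁ (eq , p))  = inj₁ (eq , f p)
decides-map f g (inj₂ (eq , ¬p)) = inj₂ (eq , ¬p ∘ g)

nonzero : ∀ {v} {P : Set} → v ≢ 0 → Decides v P → P
nonzero ≢0 (inj₁ (_ , p))  = p
nonzero ≢0 (inj₂ (≡0 , _)) = contradiction ≡0 ≢0

zero-¬ : ∀ {v} {P : Set} → v ≡ 0 → Decides v P → ¬ P
zero-¬ refl (inj₂ (_ , ¬p)) = ¬p

-- The marks occupy the `n` words after the matrix. These are zero on input, so at first no vertex
-- is marked.
record Marked {n} (G : Graph n) (D : Fin n → Bool) (m : ℕ → ℕ) : Set where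
  field
    edge-at : ∀ x y → m (suc (toℕ x * n + toℕ y)) ≡ bit (does (E? G x y))
    mark-at : ∀ x → m (suc (n * n + toℕ x)) ≡ bit (D x)

open Marked

record Ready (n : ℕ) (s : State) : Set where
  field
    size : reg s 0 ≡ n
    one  : reg s 1 ≡ 1
    base : reg s 2 ≡ suc (n * n)

open Ready

ready-preserved : ∀ {n d s s′} → Preserves (3 + d) s s′ → Ready n s → Ready n s′
ready-preserved p R = record
  { size = trans (same-reg p (s≤s z≤n)) (size R)
  ; one  = trans (same-reg p (s≤s (s≤s z≤n))) (one R)
  ; base = trans (same-reg p (s≤s (s≤s (s≤s z≤n)))) (base R)
  }

module _ {n} {G : Graph n} {D : Fin n → Bool} where

  -- Induction on the formula. Keeping every variable register below `r` places the environment in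
  -- the part that subprograms preserve.
  compile-correct :
    ∀ {k} (φ : Formula k) (ρ : Vector Reg k) (e : Vector (Fin n) k) d {s} → let r = 3 + d in
    Ready n s → Marked G D (mem s) → (∀ i → ρ i < r) → (∀ i → reg s (ρ i) ≡ toℕ (e i)) →
    Halts (compile φ ρ r) s (eval (cost φ) n) λ s′ →
      Preserves r s s′ × Decides (reg s′ r) (⟦_⟧ G D φ e)
  compile-correct (edge i j) ρ e d {s} R M ρ< ρ≡ =
    within (+-monoʳ-≤ 6 time)
      (weaken (readEdge-correct (suc d) {s} (size R) (one R) (ρ< i) (ρ< j) (ρ≡ i) (ρ≡ j))
        λ (p , v) → p , subst (λ v → Decides v (E G (e i) (e j)))
                              (sym (trans v (edge-at M (e i) (e j)))) (decides-bit (E? G (e i) (e j))))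
    where
    time : toℕ (e i) * 3 ≤ n * (3 + n * 0)
    time = *-mono-≤ (<⇒≤ (toℕ<n (e i))) (m≤m+n 3 (n * 0))
  compile-correct (dead i) ρ e d {s} R M ρ< ρ≡ =
    within (m≤m+n 2 (n * 0)) (first ⇓add (last ⇓load
      ( (preserves-refl ▹ ≤-refl ▹ ≤-refl)
      , subst (λ v → Decides v (IsTrue (D (e i)))) (sym value) (decides-bit (IsTrue? (D (e i)))) )))
    where
    r = 3 + d
    s₁ = setReg s r (reg s 2 + reg s (ρ i))

    value : reg (setReg s₁ r (mem s (reg s₁ r))) r ≡ bit (D (e i))
    value = trans (update-≡ (reg s₁) {r} refl)
      (trans (cong (mem s) (trans (update-≡ (reg s) {r} refl) (cong₂ _+_ (base R) (ρ≡ i)))) (mark-at M (e i)))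
  compile-correct (not φ) ρ e d {s} R M ρ< ρ≡ =
    within (≤-reflexive (trans (+-comm _ 1) (sym (eval-const-⊞ 1 (cost φ) n))))
      (compile-correct φ ρ e d R M ρ< ρ≡ ⨟ λ {s′} (p , dec) → last ⇓sub
        ( (p ▹ ≤-refl)
        , subst (λ v → Decides v (¬ ⟦_⟧ G D φ e))
            (sym (trans (update-≡ (reg s′) {3 + d} refl)
                        (cong (_∸ reg s′ (3 + d)) (one (ready-preserved p R)))))
            (complement dec) ))
    where
    complement : ∀ {v} {P : Set} → Decides v P → Decides (1 ∸ v) (¬ P)
    complement (inj₁ (refl , p))  = inj₂ (refl , λ ¬p → ¬p p)
    complement (inj₂ (refl , ¬p)) = inj₁ (refl , ¬p)
  compile-correct (φ and ψ) ρ e d {s} R M ρ< ρ≡ =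
    within (≤-reflexive (trans (arith _ _) (sym (trans (eval-⊞ ([ 2 ] ⊞ cost φ) (cost ψ) n)
                                                  (cong (_+ eval (cost ψ) n) (eval-const-⊞ 2 (cost φ) n))))))
      (compile-correct φ ρ e d R M ρ< ρ≡ ⨟ λ {s′} (p , dec) → branch
        (λ ≢0 → within (n≤1+n _) (weaken
          (compile-correct ψ ρ e d (ready-preserved p R) (subst (Marked G D) (sym (same-mem p)) M) ρ<
            λ i → trans (same-reg p (ρ< i)) (ρ≡ i))
          λ (p′ , dec′) → preserves-trans p p′ , conjoin (nonzero ≢0 dec) dec′))
        (λ ≡0 → within (s≤s z≤n) (last ⇓skip (p , inj₂ (≡0 , λ (x , _) → zero-¬ ≡0 dec x)))))
    where
    arith : ∀ x y → x + suc (suc y) ≡ 2 + x + y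
    arith = solve-∀

    conjoin : ∀ {v} {P Q : Set} → P → Decides v Q → Decides v (P × Q)
    conjoin p = decides-map (p ,_) proj₂
  compile-correct (some φ) ρ e d {s} R M ρ< ρ≡ =
    within time (first ⇓const (first ⇓add
      (weaken (countdown I (λ (_ , c , _) → c) body n
                 (≤-refl , counter , (preserves-refl ▹ ≤-refl ▹ n≤1+n r) , initially))
        λ (_ , _ , p , dec) → p , decides-map (λ (x , _ , q) → x , q) (λ (x , q) → x , z≤n , q) dec)))
    where
    r = 3 + d
    s₁ = setReg s r 0
    s₂ = setReg s₁ (suc r) (reg s₁ 0 + reg s₁ r)

    P : Fin n → Set
    P x = ⟦_⟧ G D φ (x ∷ᶠ e)

    -- The search runs downwards, so with `k` rounds left exactly the vertices from `k` on have been
    -- tried. Register `suc r` serves both as loop counter and, after its decrement, as the bound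
    -- variable.
    From : ℕ → Set
    From k = ∃ λ x → k ≤ toℕ x × P x

    I : ℕ → State → Set
    I k s′ = k ≤ n × reg s′ (suc r) ≡ k × Preserves r s s′ × Decides (reg s′ r) (From k)

    time : 1 + (1 + (1 + n * suc (1 + (eval (cost φ) n + 2)))) ≤ 3 + n * eval ([ 4 ] ⊞ cost φ) n
    time = ≤-reflexive (cong (λ t → 3 + n * t)
      (trans (cong (λ t → 2 + t) (+-comm (eval (cost φ) n) 2)) (sym (eval-const-⊞ 4 (cost φ) n))))

    counter : reg s₂ (suc r) ≡ n
    counter = trans (update-≡ (reg s₁) {suc r} refl)
      (trans (cong₂ _+_ (size R) (update-≡ (reg s) {r} refl)) (+-identityʳ n))

    initially : Decides (reg s₂ r) (From n)
    initially = inj₂ ( trans (update-≢ (reg s₁) {suc r} {r} (<⇒≢ ≤-refl)) (update-≡ (reg s) {r} refl)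
                     , λ (x , n≤x , _) → <⇒≱ (toℕ<n x) n≤x )

    body : ∀ {k s′} → I (suc k) s′ →
           Halts ((suc r := suc r ∸′ 1) ⨾ compile φ (suc r ∷ᶠ ρ) (2 + r) ⨾
                  (if≢0 (2 + r) then (r := 1) else skip)) s′ (1 + (eval (cost φ) n + 2)) (I k)
    body {k} {s′} (k<n , c , p , dec) =
      first ⇓sub (compile-correct φ (suc r ∷ᶠ ρ) (x ∷ᶠ e) (2 + d)
          (ready-preserved p₁ R) (subst (Marked G D) (sym (same-mem p₁)) M)
          (λ { zero → ≤-refl ; (suc i) → ≤-trans (ρ< i) (m≤n+m r 2) })
          (λ { zero → trans c₁ (sym (toℕ-fromℕ< k<n)) ; (suc i) → trans (same-reg p₁ (ρ< i)) (ρ≡ i) })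
        ⨟ λ {s″} (p′ , dec′) →
          let c″ = trans (same-reg p′ ≤-refl) c₁
              p″ = preserves-trans p₁ (preserves-≤ (m≤n+m r 2) p′)
          in branch
            (λ ≢0 → last ⇓const
              ( <⇒≤ k<n
              , trans (update-≢ (reg s″) {r} {suc r} (>⇒≢ ≤-refl)) c″
              , (p″ ▹ ≤-refl)
              , inj₁ (update-≡ (reg s″) {r} refl , x , ≤-reflexive (sym (toℕ-fromℕ< k<n)) , nonzero ≢0 dec′) ))
            (λ ≡0 → last ⇓skip
              ( <⇒≤ k<n , c″ , p″
              , subst (λ v → Decides v (From k))
                  (sym (trans (same-reg p′ (n≤1+n _)) (update-≢ (reg s′) {suc r} {r} (<⇒≢ ≤-refl))))
                  (extend (zero-¬ ≡0 dec′) dec) )))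
      where
      x = fromℕ< k<n
      s₁′ = setReg s′ (suc r) (reg s′ (suc r) ∸ reg s′ 1)

      p₁ : Preserves r s s₁′
      p₁ = p ▹ n≤1+n r

      c₁ : reg s₁′ (suc r) ≡ k
      c₁ = trans (update-≡ (reg s′) {suc r} refl) (cong₂ _∸_ c (one (ready-preserved p R)))

      extend : ∀ {v} → ¬ P x → Decides v (From (suc k)) → Decides v (From k)
      extend ¬Px = decides-map
        (λ (y , k<y , Py) → y , <⇒≤ k<y , Py)
        (λ (y , k≤y , Py) → y , ≤∧≢⇒< k≤y (λ k≡y → ¬Px (subst P (toℕ-injective (trans (sym k≡y) (sym (toℕ-fromℕ< k<n)))) Py)) , Py)

-- Redundant vertices

Alive : ∀ {n} → (Fin n → Bool) → Pred (Fin n) 0ℓ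
Alive D x = ¬ IsTrue (D x)

dominatedᶠ : ∀ {k} → Fin k → Fin k → Formula k
dominatedᶠ i j = not (some (edge (suc i) (# 0) and not (edge (suc j) (# 0))))

-- Under the quantifier, index 0 is the covering vertex, 1 the neighbour to be covered and 2 the
-- vertex under test.
coveredᶠ : Formula 2
coveredᶠ = some (not (dead (# 0)) and dominatedᶠ (# 0) (# 2) and edge (# 0) (# 1))

-- The conjuncts are `above`, `below` and `cover`. The tested vertex is excluded as a witness
-- through `dead`: the sweep marks it before evaluation.
generatedᶠ : Formula 1
generatedᶠ = some (not (dead (# 0)) and dominatedᶠ (# 1) (# 0))
         and some (not (dead (# 0)) and dominatedᶠ (# 0) (# 1))
         and not (some (edge (# 1) (# 0) and not coveredᶠ))

module _ {n} {G : Graph n} {D : Fin n → Bool} (e : Vector (Fin n) 1) where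

  generatedᶠ-correct : ⟦_⟧ G D generatedᶠ e ⇔ Generated G (Alive D) (e zero)
  generatedᶠ-correct = mk⇔
    (λ { ((p , Ap , x⊑p) , (y , Ay , y⊑x) , covered) → record
      { above = p , Ap , to (dominated-¬∃ G _ _) x⊑p
      ; below = y , Ay , to (dominated-¬∃ G _ _) y⊑x
      ; cover = λ {v} xv →
          let y , Ay , y⊑x , yv = decidable-stable (⟦_⟧? G D coveredᶠ (v ∷ᶠ e)) (λ ¬c → covered (v , xv , ¬c))
          in y , Ay , to (dominated-¬∃ G _ _) y⊑x , yv
      } })
    (λ g → let p , Ap , x⊑p = above g ; y , Ay , y⊑x = below g in
      (p , Ap , from (dominated-¬∃ G _ _) x⊑p) ,
      (y , Ay , from (dominated-¬∃ G _ _) y⊑x) ,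
      λ { (v , xv , ¬c) → let y , Ay , y⊑x , yv = cover g xv in
                          ¬c (y , Ay , from (dominated-¬∃ G _ _) y⊑x , yv) })

-- Marks

index-< : ∀ {n} (x y : Fin n) → toℕ x * n + toℕ y < n * n
index-< {n} x y =
  ≤-trans (+-monoʳ-< (toℕ x * n) (toℕ<n y))
    (≤-trans (≤-reflexive (+-comm (toℕ x * n) n)) (*-monoˡ-≤ n (toℕ<n x)))

-- Allowing any `D′` that agrees with `D` off `x` lets this serve both the tentative mark and the
-- final verdict, which may undo it.
marked-set : ∀ {n} {G : Graph n} {D D′ : Fin n → Bool} {m b x a v} → Marked G D m →
             (∀ {y} → y ≢ x → D′ y ≡ D y) → D′ x ≡ b → a ≡ suc (n * n + toℕ x) → v ≡ bit b →
             Marked G D′ (m [ a ↦ v ])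
marked-set {n} {D′ = D′} {m} {x = x} M other new refl refl = record
  { edge-at = λ y z → trans (update-≢ m (<⇒≢ (s≤s (≤-trans (index-< y z) (m≤m+n _ _))))) (edge-at M y z)
  ; mark-at = mark
  }
  where
  mark : ∀ y → (m [ suc (n * n + toℕ x) ↦ _ ]) (suc (n * n + toℕ y)) ≡ bit (D′ y)
  mark y with y ≟ᶠ x
  ... | yes refl = trans (update-≡ m {suc (n * n + toℕ x)} refl) (cong bit (sym new))
  ... | no  y≢x  = trans (update-≢ m (y≢x ∘ toℕ-injective ∘ +-cancelˡ-≡ (n * n) _ _ ∘ suc-injective))
                         (trans (mark-at M y) (cong bit (sym (other y≢x))))

-- Register 3 is the current vertex, 4 the address of its mark and 5 the verdict. The vertex is
-- marked tentatively, tested against the remaining ones, and its mark is overwritten by the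
-- verdict.
sweepBody : Prog
sweepBody = (3 := 3 ∸′ 1) ⨾ (4 := 2 +′ 3) ⨾ (mem[ 4 ]:= 1) ⨾
            compile generatedᶠ (const 3) 5 ⨾ (mem[ 4 ]:= 5)

sweep : Prog
sweep = (3 := 0) ⨾ (3 := 0 +′ 3) ⨾ (while≢0 3 loop sweepBody)

sweepCost : Poly
sweepCost = 3 ∷ [ 5 ] ⊞ cost generatedᶠ

module _ {n} {G : Graph n} where

  -- The sweep invariant when the vertices from `k` on have been processed.
  record Reduced (D : Fin n → Bool) (k : ℕ) : Set where
    field
      spans     : ∀ x → Generated G (Alive D) x
      untouched : ∀ x → toℕ x < k → Alive D x
      needed    : ∀ x → k ≤ toℕ x → Alive D x → ¬ Generated G (λ y → Alive D y × y ≢ x) x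

  open Reduced

  module _ {D} {x : Fin n} (red : Reduced D (suc (toℕ x))) where

    kill : Fin n → Bool
    kill = updateAt D x (const true)

    kill-same : kill x ≡ true
    kill-same = updateAt-updates x D

    kill-other : ∀ {y} → y ≢ x → kill y ≡ D y
    kill-other {y} y≢x = updateAt-minimal y x D y≢x

    alive-kill⁺ : ∀ {y} → Alive D y → y ≢ x → Alive kill y
    alive-kill⁺ Ay y≢x = subst (¬_ ∘ IsTrue) (sym (kill-other y≢x)) Ay

    alive-kill⁻ : ∀ {y} → Alive kill y → Alive D y × y ≢ x
    alive-kill⁻ {y} Ay with y ≟ᶠ x
    ... | yes refl = contradiction (subst IsTrue (sym kill-same) _) Ay
    ... | no  y≢x  = subst (¬_ ∘ IsTrue) (kill-other y≢x) Ay , y≢x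

    -- Whatever `x` helped to generate is generated through the generators of `x`. Vertices already
    -- found needed remain so, because generation is monotone in the available set; hence one pass
    -- suffices.
    reduced-kill : Generated G (Alive kill) x → Reduced kill (toℕ x)
    reduced-kill g = record
      { spans     = λ z → generated-trans regenerate (spans red z)
      ; untouched = λ y y<x → alive-kill⁺ (untouched red y (m≤n⇒m≤1+n y<x)) (<⇒≢ y<x ∘ cong toℕ)
      ; needed    = λ y x≤y Ay g → let Ay′ , y≢x = alive-kill⁻ Ay in
          needed red y (≤∧≢⇒< x≤y (y≢x ∘ sym ∘ toℕ-injective)) Ay′
            (generated-mono (λ (Az , z≢y) → proj₁ (alive-kill⁻ Az) , z≢y) g)
      }
      where
      regenerate : ∀ {y} → Alive D y → Generated G (Alive kill) y
      regenerate {y} Ay with y ≟ᶠ x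
      ... | yes refl = g
      ... | no  y≢x  = generated-refl (alive-kill⁺ Ay y≢x)

    reduced-keep : ¬ Generated G (Alive kill) x → Reduced D (toℕ x)
    reduced-keep ¬g = record
      { spans     = spans red
      ; untouched = λ y y<x → untouched red y (m≤n⇒m≤1+n y<x)
      ; needed    = need
      }
      where
      need : ∀ y → toℕ x ≤ toℕ y → Alive D y → ¬ Generated G (λ z → Alive D z × z ≢ y) y
      need y x≤y Ay with y ≟ᶠ x
      ... | yes refl = ¬g ∘ generated-mono λ (Az , z≢x) → alive-kill⁺ Az z≢x
      ... | no  y≢x  = needed red y (≤∧≢⇒< x≤y (y≢x ∘ sym ∘ toℕ-injective)) Ay

  reduced-initial : Reduced (const false) n
  reduced-initial = record
    { spans     = λ x → generated-refl λ ()
    ; untouched = λ x _ ()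
    ; needed    = λ x n≤x → contradiction n≤x (<⇒≱ (toℕ<n x))
    }

  private
    Swept : ℕ → State → Set
    Swept k s = ∃ λ D → k ≤ n × reg s 3 ≡ k × Ready n s × Marked G D (mem s) × Reduced D k

    sweepBody-correct : ∀ {k s} → Swept (suc k) s →
                        Halts sweepBody s (4 + eval (cost generatedᶠ) n) (Swept k)
    sweepBody-correct {k} {s} (D , k<n , c , R , M , red) with fromℕ< k<n | toℕ-fromℕ< k<n
    ... | x | refl =
      within (≤-reflexive (cong (3 +_) (+-comm _ 1)))
        (first ⇓sub (first ⇓add (first ⇓store
          (compile-correct generatedᶠ (const 3) (const x) 2 R₃ M₃ (λ _ → s≤s (s≤s (s≤s (s≤s z≤n)))) (λ _ → c₁)
           ⨟ λ {s′} (p , dec) → last ⇓store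
             (finish (proj₁ (outcome s′ dec)) p (proj₂ (outcome s′ dec)))))))
      where
      s₁ = setReg s 3 (reg s 3 ∸ reg s 1)
      s₂ = setReg s₁ 4 (reg s₁ 2 + reg s₁ 3)
      s₃ = setMem s₂ (reg s₂ 4) (reg s₂ 1)

      c₁ : reg s₃ 3 ≡ toℕ x
      c₁ = cong₂ _∸_ c (one R)

      a₁ : reg s₃ 4 ≡ suc (n * n + toℕ x)
      a₁ = cong₂ _+_ (base R) c₁

      R₃ : Ready n s₃
      R₃ = record { size = size R ; one = one R ; base = base R }

      M₃ : Marked G (kill red) (mem s₃)
      M₃ = marked-set M (kill-other red) (kill-same red) a₁ (one R)

      Outcome : State → (Fin n → Bool) → Set
      Outcome s′ D′ = ∃ λ b → (∀ {y} → y ≢ x → D′ y ≡ kill red y) × D′ x ≡ b × reg s′ 5 ≡ bit b ×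
                      Reduced D′ (toℕ x)

      outcome : ∀ s′ → Decides (reg s′ 5) (⟦_⟧ G (kill red) generatedᶠ (const x)) → ∃ (Outcome s′)
      outcome s′ (inj₁ (v , g)) =
        kill red , true , (λ _ → refl) , kill-same red , v , reduced-kill red (to (generatedᶠ-correct (const x)) g)
      outcome s′ (inj₂ (v , ¬g)) =
        D , D x , (λ y≢x → sym (kill-other red y≢x)) , refl , trans v (sym (cong bit alive)) ,
        reduced-keep red (¬g ∘ from (generatedᶠ-correct (const x)))
        where
        -- The verdict 0 restores the previous mark, since an unprocessed vertex was unmarked.
        alive : D x ≡ false
        alive with D x | untouched red x ≤-refl
        ... | true  | A = contradiction _ A
        ... | false | _ = refl

      finish : ∀ {s′} D′ → Preserves 5 s₃ s′ → Outcome s′ D′ → Swept (toℕ x) (setMem s′ (reg s′ 4) (reg s′ 5))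
      finish {s′} D′ p (b , other , new , v , red′) =
        D′ , <⇒≤ k<n , trans (same-reg p (s≤s (s≤s (s≤s (s≤s z≤n))))) c₁
        , record { size = size R′ ; one = one R′ ; base = base R′ }
        , marked-set (subst (Marked G (kill red)) (sym (same-mem p)) M₃) other new
                     (trans (same-reg p ≤-refl) a₁) v
        , red′
        where R′ = ready-preserved (preserves-≤ (s≤s (s≤s (s≤s z≤n))) p) R₃

  sweep-correct : ∀ {s} → Ready n s → Marked G (const false) (mem s) →
                  Halts sweep s (eval sweepCost n)
                    λ s′ → Ready n s′ × ∃ λ D → Marked G D (mem s′) × Reduced D 0
  sweep-correct R M = within (≤-reflexive (cong (λ t → 3 + n * t) (sym (eval-const-⊞ 5 (cost generatedᶠ) n))))
    (first ⇓const (first ⇓add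
      (weaken (countdown Swept (λ (_ , _ , c , _) → c) sweepBody-correct n
                 ( const false , ≤-refl , trans (+-identityʳ _) (size R)
                 , record { size = size R ; one = one R ; base = base R } , M , reduced-initial ))
              λ (D , _ , _ , R′ , M′ , red) → R′ , D , M′ , red)))

open Reduced

-- Words in memory

load-++ˡ : ∀ ws {ws′ a} → a < length ws → load (ws ++ ws′) a ≡ load ws a
load-++ˡ (w ∷ ws) {a = zero}  _         = refl
load-++ˡ (w ∷ ws) {a = suc a} (s≤s a<) = load-++ˡ ws a<

load-++ʳ : ∀ ws {ws′} a → load (ws ++ ws′) (length ws + a) ≡ load ws′ a
load-++ʳ []       a = refl
load-++ʳ (w ∷ ws) a = load-++ʳ ws a

load-lookup : ∀ ws i → load ws (toℕ i) ≡ lookup ws i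
load-lookup (w ∷ ws) zero    = refl
load-lookup (w ∷ ws) (suc i) = load-lookup ws i

load-tabulate : ∀ {n} (f : Fin n → ℕ) i → load (tabulate f) (toℕ i) ≡ f i
load-tabulate f zero    = refl
load-tabulate f (suc i) = load-tabulate (f ∘ suc) i

load-beyond : ∀ ws a → load ws (length ws + a) ≡ 0
load-beyond []       a = refl
load-beyond (w ∷ ws) a = load-beyond ws a

module _ {A B C : Set} (f : A → B → C) where

  length-cartesianProductWith : ∀ xs ys → length (cartesianProductWith f xs ys) ≡ length xs * length ys
  length-cartesianProductWith []       ys = refl
  length-cartesianProductWith (x ∷ xs) ys =
    trans (length-++ (map (f x) ys)) (cong₂ _+_ (length-map (f x) ys) (length-cartesianProductWith xs ys))

  cartesianProductWith-∷ʳ : ∀ xs x ys →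
    cartesianProductWith f (xs ∷ʳ x) ys ≡ cartesianProductWith f xs ys ++ map (f x) ys
  cartesianProductWith-∷ʳ xs x ys =
    trans (cartesianProductWith-distribʳ-++ f xs [ x ] ys)
          (cong (cartesianProductWith f xs ys ++_) (++-identityʳ (map (f x) ys)))

  cartesianProductWith-map : ∀ {D : Set} (g : D → A) (h : D → B) xs ys →
    cartesianProductWith (λ x y → f (g x) (h y)) xs ys ≡ cartesianProductWith f (map g xs) (map h ys)
  cartesianProductWith-map g h []       ys = refl
  cartesianProductWith-map g h (x ∷ xs) ys = cong₂ _++_ (map-∘ ys) (cartesianProductWith-map g h xs ys)

-- Induction on the row index, with `g` generalised because dropping the first row replaces `g` by
-- `g ∘ suc`.
load-cartesianProductWith : ∀ {A B : Set} (f : A → B → ℕ) {m n} (g : Fin m → A) (h : Fin n → B) i j →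
  load (cartesianProductWith f (tabulate g) (tabulate h)) (toℕ i * n + toℕ j) ≡ f (g i) (h j)
load-cartesianProductWith f {n = n} g h i j = go g i
  where
  row : ∀ x → length (map (f x) (tabulate h)) ≡ n
  row x = trans (length-map (f x) (tabulate h)) (length-tabulate h)

  go : ∀ {m} (g : Fin m → _) i →
       load (cartesianProductWith f (tabulate g) (tabulate h)) (toℕ i * n + toℕ j) ≡ f (g i) (h j)
  go g zero =
    trans (load-++ˡ (map (f (g zero)) (tabulate h)) (subst (toℕ j <_) (sym (row (g zero))) (toℕ<n j)))
      (trans (cong (λ ws → load ws (toℕ j)) (map-tabulate h (f (g zero)))) (load-tabulate (f (g zero) ∘ h) j))
  go g (suc i) =
    trans (cong (load (cartesianProductWith f (tabulate g) (tabulate h)))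
            (trans (+-assoc n (toℕ i * n) (toℕ j))
                   (cong (_+ (toℕ i * n + toℕ j)) (sym (row (g zero))))))
      (trans (load-++ʳ (map (f (g zero)) (tabulate h)) (toℕ i * n + toℕ j)) (go (g ∘ suc) i))

adjacency : ∀ {n} → Graph n → Fin n → Fin n → ℕ
adjacency G x y = bit (does (E? G x y))

marked-encode : ∀ {n} (G : Graph n) → Marked G (const false) (load (encode G))
marked-encode {n} G = record
  { edge-at = load-cartesianProductWith (adjacency G) id id
  ; mark-at = λ x → trans (cong (λ l → load (encode G) (suc (l + toℕ x))) (sym words))
                          (load-beyond (encode G) (toℕ x))
  }
  where
  words : length (cartesianProductWith (adjacency G) (allFin n) (allFin n)) ≡ n * n
  words = trans (length-cartesianProductWith (adjacency G) (allFin n) (allFin n))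
               (cong₂ _*_ (length-tabulate {n = n} id) (length-tabulate {n = n} id))

-- All registers start at 0: register 0 therefore addresses the size word, and adding register 4
-- makes a copy. Starting the product at 1 yields the address of the first mark.
setup : Prog
setup = (0 :=mem[ 0 ]) ⨾ (1 := 1) ⨾ (2 := 1) ⨾ (3 := 0 +′ 4) ⨾ multiply 2

setup-correct : ∀ {n} (G : Graph n) →
                Halts setup (initial (encode G)) (eval (5 ∷ 3 ∷ []) n)
                  λ s → Ready n s × Marked G (const false) (mem s)
setup-correct {n} G = within (+-monoʳ-≤ 5 (*-monoʳ-≤ n (m≤m+n 3 (n * 0))))
  (first ⇓load (first ⇓const (first ⇓const (first ⇓add
    (weaken (multiply-correct 0 {k = n} refl refl (+-identityʳ n)) λ (p , v) →
      record { size = same-reg p (s≤s z≤n) ; one = same-reg p (s≤s (s≤s z≤n)) ; base = v } ,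
      subst (Marked G (const false)) (sym (same-mem p)) (marked-encode G))))))

-- The output `ws` grows from address 1 over the original memory `m₀`. Address 0 is left open, as
-- the size is written last.
record Tape (m₀ : ℕ → ℕ) (ws : List ℕ) (m : ℕ → ℕ) : Set where
  field
    written : ∀ {a} → a < length ws → m (suc a) ≡ load ws a
    beyond  : ∀ {a} → length ws < a → m a ≡ m₀ a

open Tape

tape-∷ʳ : ∀ {m₀ ws m b a v} → Tape m₀ ws m → a ≡ suc (length ws) → v ≡ b →
          Tape m₀ (ws ∷ʳ b) (m [ a ↦ v ])
tape-∷ʳ {m₀} {ws} {m} {b} tape refl refl = record
  { written = λ {a} a< → write a (subst (a <_) (length-∷ʳ) a<)
  ; beyond  = λ {a} <a → let ws<a = subst (_< a) length-∷ʳ <a in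
              trans (update-≢ m (>⇒≢ ws<a)) (beyond tape (<⇒≤ ws<a))
  }
  where
  length-∷ʳ : length (ws ∷ʳ b) ≡ suc (length ws)
  length-∷ʳ = trans (length-++ ws) (+-comm (length ws) 1)

  write : ∀ a → a < suc (length ws) → (m [ suc (length ws) ↦ b ]) (suc a) ≡ load (ws ∷ʳ b) a
  write a (s≤s a≤) with a ≟ length ws
  ... | yes refl = trans (update-≡ m {suc (length ws)} refl)
                     (sym (trans (cong (load (ws ∷ʳ b)) (sym (+-identityʳ (length ws)))) (load-++ʳ ws 0)))
  ... | no  a≢   = trans (update-≢ m (a≢ ∘ suc-injective))
                     (trans (written tape (≤∧≢⇒< a≤ a≢)) (sym (load-++ˡ ws (≤∧≢⇒< a≤ a≢))))

-- Surviving vertices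

module _ {n} (D : Fin n → Bool) where

  Alive? : ∀ x → Dec (Alive D x)
  Alive? x = ¬? (IsTrue? (D x))

  -- Indexed by prefixes to match the ascending output loops: passing a vertex appends that vertex
  -- or nothing.
  survivors : ℕ → List (Fin n)
  survivors k = filter Alive? (take k (allFin n))

  private
    survivors-snoc : ∀ x → survivors (suc (toℕ x)) ≡ survivors (toℕ x) ++ filter Alive? [ x ]
    survivors-snoc x =
      trans (cong (filter Alive?) (take-suc-tabulate id x)) (filter-++ Alive? (take (toℕ x) (allFin n)) [ x ])

  survivors-alive : ∀ {x} → Alive D x → survivors (suc (toℕ x)) ≡ survivors (toℕ x) ∷ʳ x
  survivors-alive {x} Ax = trans (survivors-snoc x) (cong (survivors (toℕ x) ++_) (filter-accept Alive? Ax))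

  survivors-dead : ∀ {x} → ¬ Alive D x → survivors (suc (toℕ x)) ≡ survivors (toℕ x)
  survivors-dead {x} ¬Ax =
    trans (survivors-snoc x) (trans (cong (survivors (toℕ x) ++_) (filter-reject Alive? ¬Ax)) (++-identityʳ _))

  length-survivors : ∀ k → length (survivors k) ≤ k
  length-survivors k = ≤-trans (length-filter Alive? (take k (allFin n)))
    (≤-trans (≤-reflexive (length-take k (allFin n))) (m⊓n≤m k _))

  survivors-all : survivors n ≡ filter Alive? (allFin n)
  survivors-all = cong (filter Alive?) (take-all n (allFin n) (≤-reflexive (length-tabulate {n = n} id)))

  alive⇒survivor : ∀ {x} → Alive D x → x ∈ survivors n
  alive⇒survivor Ax = subst (_ ∈_) (sym survivors-all) (∈-filter⁺ Alive? (∈-allFin _) Ax)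

  survivor⇒alive : ∀ {x} → x ∈ survivors n → Alive D x
  survivor⇒alive {x} x∈ = proj₂ (∈-filter⁻ Alive? {xs = take n (allFin n)} x∈)

  survivors-unique : Unique (survivors n)
  survivors-unique = subst Unique (sym survivors-all) (filter⁺ Alive? (allFin⁺ n))

-- The graph induced by the survivors

lookup-injective : ∀ {A : Set} {xs : List A} → Unique xs → Injective _≡_ _≡_ (lookup xs)
lookup-injective (_ ∷ u)      {zero}  {zero}  eq = refl
lookup-injective (x∉ ∷ u)     {zero}  {suc j} eq = contradiction eq (All.lookup x∉ (∈-lookup j))
lookup-injective (x∉ ∷ u)     {suc i} {zero}  eq = contradiction (sym eq) (All.lookup x∉ (∈-lookup i))
lookup-injective (_ ∷ u)      {suc i} {suc j} eq = cong suc (lookup-injective u eq)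

core : ∀ {n} (G : Graph n) (D : Fin n → Bool) → Graph (length (survivors D n))
core {n} G D = induced G (lookup (survivors D n))

-- `spans` gives the equivalence with `G`. `needed` at bound 0 concerns every survivor, and
-- `generated-induced` turns it into irreducibility of the core.
core-IsRCoreOf : ∀ {n} {G : Graph n} {D} → Reduced {G = G} D 0 → core G D IsRCoreOf G
core-IsRCoreOf {n} {G} {D} red = irreducible⇒RCore irreducible , induced∼w {G = G} spans-image
  where
  ι = lookup (survivors D n)

  alive : ∀ {x} → Image ι x → Alive D x
  alive (i , refl) = survivor⇒alive D (∈-lookup i)

  spans-image : ∀ x → Generated G (Image ι) x
  spans-image x = generated-mono
    (λ Ay → index (alive⇒survivor D Ay) , sym (lookup-index (alive⇒survivor D Ay))) (spans red x)

  irreducible : ∀ i → ¬ Generated (core G D) (_≢ i) i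
  irreducible i g = needed red (ι i) z≤n (alive (i , refl))
    (generated-mono (λ (y∈ , y≢) → alive y∈ , y≢)
      (generated-induced {G = G} spans-image (lookup-injective (survivors-unique D)) g))

encode-core : ∀ {n} (G : Graph n) D → let L = survivors D n in
              encode (core G D) ≡ length L ∷ cartesianProductWith (adjacency G) L L
encode-core {n} G D = cong (length L ∷_)
  (trans (cartesianProductWith-map (adjacency G) (lookup L) (lookup L) (allFin _) (allFin _))
    (cong₂ (cartesianProductWith (adjacency G)) all all))
  where
  L = survivors D n

  all : map (lookup L) (allFin (length L)) ≡ L
  all = trans (map-tabulate id (lookup L)) (tabulate-lookup L)

-- Writing the adjacency matrix of the core over that of the graph

-- Registers 3 and 7 count the rows and columns left, 4 and 8 are the current row and column, 5 is
-- the write pointer, 6 the number of survivors met and 9 scratch.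
rowBody : Prog
rowBody =
  (9 := 2 +′ 8) ⨾ (9 :=mem[ 9 ]) ⨾
  (if≢0 9 then skip else (readEdge 4 8 9 ⨾ (mem[ 5 ]:= 9) ⨾ (5 := 5 +′ 1))) ⨾
  (8 := 8 +′ 1) ⨾ (7 := 7 ∸′ 1)

writeRow : Prog
writeRow = (7 := 0) ⨾ (7 := 0 +′ 7) ⨾ (8 := 0) ⨾ (while≢0 7 loop rowBody)

matrixBody : Prog
matrixBody =
  (9 := 2 +′ 4) ⨾ (9 :=mem[ 9 ]) ⨾
  (if≢0 9 then skip else ((6 := 6 +′ 1) ⨾ writeRow)) ⨾
  (4 := 4 +′ 1) ⨾ (3 := 3 ∸′ 1)

writeCore : Prog
writeCore =
  (3 := 0) ⨾ (3 := 0 +′ 3) ⨾ (4 := 0) ⨾ (5 := 1) ⨾ (6 := 0) ⨾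
  (while≢0 3 loop matrixBody) ⨾ (9 := 0) ⨾ (mem[ 9 ]:= 6)

private
  split : ∀ {k j n} → k + suc j ≡ n → ∃ λ (x : Fin n) → toℕ x ≡ k
  split {k} {j} refl = fromℕ< k< , toℕ-fromℕ< k<
    where k< = m<m+n k (s≤s z≤n)

module _ {n} {G : Graph n} {D : Fin n → Bool} {m₀ : ℕ → ℕ} (M : Marked G D m₀) where

  private
    L = survivors D
    f = adjacency G

    Emitted : List ℕ → State → Set
    Emitted ws s = reg s 5 ≡ suc (length ws) × Tape m₀ ws (mem s)

    -- All unread input lies at or beyond the write pointer.
    read-mark : ∀ {ws m a} x → Tape m₀ ws m → length ws ≤ n * n → a ≡ suc (n * n + toℕ x) →
                Decides (m a) (IsTrue (D x))
    read-mark x tape ws≤ refl = subst (λ v → Decides v (IsTrue (D x)))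
      (sym (trans (beyond tape (s≤s (≤-trans ws≤ (m≤m+n _ _)))) (mark-at M x))) (decides-bit (IsTrue? (D x)))

    module Row (x : Fin n) (ws₀ : List ℕ) (ws₀≤ : length ws₀ ≤ toℕ x * n) (j₀ l₀ : ℕ) where

      row : ℕ → List ℕ
      row k = ws₀ ++ map (f x) (L k)

      -- This makes overwriting in place safe: before cell `(x , k)` is read, at most
      -- `toℕ x * n + k` words have been written, so the pointer has not passed that cell.
      row≤ : ∀ k → length (row k) ≤ toℕ x * n + k
      row≤ k = ≤-trans (≤-reflexive (trans (length-++ ws₀) (cong (length ws₀ +_) (length-map (f x) (L k)))))
                       (+-mono-≤ ws₀≤ (length-survivors D k))

      Outer : State → Set
      Outer s = reg s 3 ≡ j₀ × reg s 4 ≡ toℕ x × reg s 6 ≡ l₀ × Ready n s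

      -- `k` and `l` are separate because the output already accounts for the current column before
      -- register 8 advances.
      Progress : ℕ → ℕ → ℕ → State → Set
      Progress k l j s = reg s 7 ≡ j × reg s 8 ≡ k × Outer s × Emitted (row l) s

      I : ℕ → State → Set
      I j s = ∃ λ k → k + j ≡ n × Progress k k j s

      rowBody-correct : ∀ {j s} → I (suc j) s → Halts rowBody s (eval (13 ∷ 3 ∷ []) n) (I j)
      rowBody-correct {j} {s} (k , k+j , c , i , (c₃ , c₄ , c₆ , R) , w , tape) with split k+j
      ... | y , refl = within time (first ⇓add (first ⇓load
          (branch {Q = Progress (toℕ y) (suc (toℕ y)) (suc j)}
            (λ ≢0 → within (s≤s z≤n) (last ⇓skip
               (c , i , outer , subst (λ l → Emitted (ws₀ ++ map (f x) l) s₂)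
                  (sym (survivors-dead D λ Ay → Ay (nonzero ≢0 dead?))) (w , tape))))
            (λ ≡0 → readEdge-correct 7 (size R) (one R) (<ᵇ⇒< 4 9 _) (<ᵇ⇒< 8 9 _) c₄ i
               ⨟ λ {s′} (p , v) → first ⇓store (last ⇓add
                 ( trans (same-reg p (<ᵇ⇒< 7 9 _)) c
                 , trans (same-reg p (<ᵇ⇒< 8 9 _)) i
                 , outer-preserved p
                 , emit p v (zero-¬ ≡0 dead?) )))
           ⨟ λ { {s′} (c′ , i′ , (d₃ , d₄ , d₆ , R′) , w′ , tape′) → first ⇓add (last ⇓sub
             ( suc (toℕ y) , trans (sym (+-suc (toℕ y) j)) k+j
             , cong₂ _∸_ c′ (one R′)
             , trans (cong₂ _+_ i′ (one R′)) (+-comm (toℕ y) 1)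
             , (d₃ , d₄ , d₆ , record { size = size R′ ; one = one R′ ; base = base R′ })
             , w′ , tape′ )) })))
        where
        s₁ = setReg s 9 (reg s 2 + reg s 8)
        s₂ = setReg s₁ 9 (mem s (reg s₁ 9))

        time : 2 + (suc (6 + toℕ x * 3 + 2) + 2) ≤ 13 + n * (3 + n * 0)
        time = ≤-trans (≤-reflexive (arith (toℕ x * 3)))
                 (+-monoʳ-≤ 13 (*-mono-≤ (<⇒≤ (toℕ<n x)) (m≤m+n 3 (n * 0))))
          where
          arith : ∀ t → 2 + (suc (6 + t + 2) + 2) ≡ 13 + t
          arith = solve-∀

        dead? : Decides (mem s (reg s₁ 9)) (IsTrue (D y))
        dead? = read-mark y tape (≤-trans (row≤ (toℕ y)) (<⇒≤ (index-< x y))) (cong₂ _+_ (base R) i)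

        R₂ : Ready n s₂
        R₂ = record { size = size R ; one = one R ; base = base R }

        outer : Outer s₂
        outer = c₃ , c₄ , c₆ , R₂

        outer-preserved : ∀ {s′} → Preserves 9 s₂ s′ →
          let s″ = setMem s′ (reg s′ 5) (reg s′ 9) in Outer (setReg s″ 5 (reg s″ 5 + reg s″ 1))
        outer-preserved p =
          trans (same-reg p (<ᵇ⇒< 3 9 _)) c₃ , trans (same-reg p (<ᵇ⇒< 4 9 _)) c₄ ,
          trans (same-reg p (<ᵇ⇒< 6 9 _)) c₆ ,
          (let R′ = ready-preserved (preserves-≤ (<⇒≤ (<ᵇ⇒< 3 9 _)) p) R₂
           in record { size = size R′ ; one = one R′ ; base = base R′ })

        emit : ∀ {s′} → Preserves 9 s₂ s′ → reg s′ 9 ≡ mem s₂ (suc (toℕ x * n + toℕ y)) → Alive D y →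
          let s″ = setMem s′ (reg s′ 5) (reg s′ 9) in
          Emitted (row (suc (toℕ y))) (setReg s″ 5 (reg s″ 5 + reg s″ 1))
        emit {s′} p v Ay = subst (λ ws → Emitted ws (setReg s″ 5 (reg s″ 5 + reg s″ 1))) extended
          ( trans (cong₂ _+_ w′ (trans (same-reg p (<ᵇ⇒< 1 9 _)) (one R)))
              (trans (+-comm _ 1) (cong suc (sym (trans (length-++ (row (toℕ y))) (+-comm _ 1)))))
          , tape-∷ʳ (subst (Tape m₀ (row (toℕ y))) (sym (same-mem p)) tape) w′
              (trans v (trans (beyond tape (s≤s (row≤ (toℕ y)))) (edge-at M x y))) )
          where
          s″ = setMem s′ (reg s′ 5) (reg s′ 9)

          w′ : reg s′ 5 ≡ suc (length (row (toℕ y)))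
          w′ = trans (same-reg p (<ᵇ⇒< 5 9 _)) w

          extended : row (toℕ y) ∷ʳ f x y ≡ row (suc (toℕ y))
          extended = trans (++-assoc ws₀ (map (f x) (L (toℕ y))) [ f x y ])
            (cong (ws₀ ++_) (trans (sym (map-++ (f x) (L (toℕ y)) [ y ]))
                                   (cong (map (f x)) (sym (survivors-alive D Ay)))))

      writeRow-correct : ∀ {s} → Outer s → Emitted ws₀ s →
                         Halts writeRow s (eval (4 ∷ 14 ∷ 3 ∷ []) n) λ s′ → Outer s′ × Emitted (row n) s′
      writeRow-correct {s} (c₃ , c₄ , c₆ , R) e =
        first ⇓const (first ⇓add (first ⇓const
          (weaken (countdown I (λ (_ , _ , c , _) → c) rowBody-correct n
                     ( 0 , refl , trans (+-identityʳ _) (size R) , refl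
                     , (c₃ , c₄ , c₆ , record { size = size R ; one = one R ; base = base R })
                     , subst (λ ws → Emitted ws s) (sym (++-identityʳ ws₀)) e ))
            λ {s′} (k , k+0 , _ , _ , o , e′) →
              o , subst (λ k → Emitted (row k) s′) (trans (sym (+-identityʳ k)) k+0) e′)))

    rows : ℕ → List ℕ
    rows k = cartesianProductWith f (L k) (L n)

    rows≤ : ∀ k → length (rows k) ≤ k * n
    rows≤ k = ≤-trans (≤-reflexive (length-cartesianProductWith f (L k) (L n)))
                      (*-mono-≤ (length-survivors D k) (length-survivors D n))

    Progress : ℕ → ℕ → ℕ → State → Set
    Progress k l j s = reg s 3 ≡ j × reg s 4 ≡ k × reg s 6 ≡ length (L l) × Ready n s × Emitted (rows l) s

    I : ℕ → State → Set
    I j s = ∃ λ k → k + j ≡ n × Progress k k j s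

    matrixBody-correct : ∀ {j s} → I (suc j) s → Halts matrixBody s (eval (10 ∷ 14 ∷ 3 ∷ []) n) (I j)
    matrixBody-correct {j} {s} (k , k+j , c , i , l , R , w , tape) with split k+j
    ... | x , refl = within (≤-reflexive time) (first ⇓add (first ⇓load
        (branch {Q = Progress (toℕ x) (suc (toℕ x)) (suc j)}
          (λ ≢0 → within (s≤s z≤n) (last ⇓skip
             (c , i ,
              subst (λ l → reg s 6 ≡ length l × Ready n s₂ × Emitted (cartesianProductWith f l (L n)) s₂)
                (sym (survivors-dead D λ Ax → Ax (nonzero ≢0 dead?))) (l , R₂ , w , tape))))
          (λ ≡0 → first ⇓add (weaken
             (writeRow-correct (c , i , trans (cong₂ _+_ l (one R)) (+-comm _ 1) , R₃) (w , tape))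
             λ {s′} ((c′ , i′ , l′ , R′) , e) → c′ , i′ ,
               subst (λ l → reg s′ 6 ≡ length l × Ready n s′ × Emitted (cartesianProductWith f l (L n)) s′)
                 (sym (survivors-alive D (zero-¬ ≡0 dead?)))
                 ( trans l′ (sym (trans (length-++ (L (toℕ x))) (+-comm _ 1))) , R′
                 , subst (λ ws → Emitted ws s′) (sym (cartesianProductWith-∷ʳ f (L (toℕ x)) x (L n))) e )))
         ⨟ λ { (c′ , i′ , l′ , R′ , e) → first ⇓add (last ⇓sub
           ( suc (toℕ x) , trans (sym (+-suc (toℕ x) j)) k+j
           , cong₂ _∸_ c′ (one R′)
           , trans (cong₂ _+_ i′ (one R′)) (+-comm (toℕ x) 1)
           , l′ , record { size = size R′ ; one = one R′ ; base = base R′ } , e )) })))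
      where
      -- Register 6 is incremented before the row is written, hence the successor of the number of
      -- earlier survivors.
      open Row x (rows (toℕ x)) (rows≤ (toℕ x)) (suc j) (suc (length (L (toℕ x)))) using (writeRow-correct)

      s₁ = setReg s 9 (reg s 2 + reg s 4)
      s₂ = setReg s₁ 9 (mem s (reg s₁ 9))
      s₃ = setReg s₂ 6 (reg s₂ 6 + reg s₂ 1)

      time : 2 + (suc (1 + eval (4 ∷ 14 ∷ 3 ∷ []) n) + 2) ≡ eval (10 ∷ 14 ∷ 3 ∷ []) n
      time = cong (2 +_) (+-comm _ 2)

      dead? : Decides (mem s (reg s₁ 9)) (IsTrue (D x))
      dead? = read-mark x tape (≤-trans (rows≤ (toℕ x)) (*-monoˡ-≤ n (<⇒≤ (toℕ<n x)))) (cong₂ _+_ (base R) i)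

      R₂ : Ready n s₂
      R₂ = record { size = size R ; one = one R ; base = base R }

      R₃ : Ready n s₃
      R₃ = record { size = size R ; one = one R ; base = base R }

  writeCore-correct : ∀ {s} → Ready n s → mem s ≡ m₀ →
                      Halts writeCore s (eval (8 ∷ 11 ∷ 14 ∷ 3 ∷ []) n) λ s′ → Outputs s′ (encode (core G D))
  writeCore-correct {s} R refl = within (≤-reflexive (cong (5 +_) (+-comm _ 2)))
    (first ⇓const (first ⇓add (first ⇓const (first ⇓const (first ⇓const
      (countdown I (λ (_ , _ , c , _) → c) matrixBody-correct n
         ( 0 , refl , trans (+-identityʳ _) (size R) , refl , refl
         , record { size = size R ; one = one R ; base = base R }
         , refl , record { written = λ () ; beyond = λ _ → refl } )
       ⨟ λ { {s′} (k , k+0 , _ , _ , l , _ , _ , tape) →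
         first ⇓const (last ⇓store (output s′ k (trans (sym (+-identityʳ k)) k+0) l tape)) }))))))
    where
    output : ∀ s′ k → k ≡ n → reg s′ 6 ≡ length (L k) → Tape m₀ (rows k) (mem s′) →
             Outputs ⟨ reg s′ [ 9 ↦ 0 ] , mem s′ [ 0 ↦ reg s′ 6 ] ⟩ (encode (core G D))
    output s′ k refl l tape =
      subst (Outputs ⟨ reg s′ [ 9 ↦ 0 ] , mem s′ [ 0 ↦ reg s′ 6 ] ⟩) (sym (encode-core G D)) words
      where
      words : Outputs ⟨ reg s′ [ 9 ↦ 0 ] , mem s′ [ 0 ↦ reg s′ 6 ] ⟩ (length (L n) ∷ rows n)
      words zero    = l
      words (suc i) = trans (written tape (toℕ<n i)) (load-lookup (rows n) i)

-- The complete program and its time bound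

mainTheorem9 : ∃ λ (c : Prog) → ∃ λ (p : Poly) →
    ∀ {n : ℕ} (G : Graph n) →
    ∃ λ (m : ℕ) → ∃ λ (H : Graph m) → ∃ λ (s : State) → ∃ λ (t : ℕ) →
    c ⊢ initial (encode G) ⇓[ t ] s × t ≤ eval p n × Outputs s (encode H) × H IsRCoreOf G
-- The bounds of the three phases are added. The sweep dominates with degree five: three nested
-- quantifiers, a linear-time edge lookup and the pass over the vertices.
mainTheorem9 = setup ⨾ sweep ⨾ writeCore , (5 ∷ 3 ∷ []) ⊞ (sweepCost ⊞ (8 ∷ 11 ∷ 14 ∷ 3 ∷ [])) , λ {n} G →
  let halted {s} {t} r b (D , out , red) = correct G
  in length (survivors D n) , core G D , s , t , r , b , out , core-IsRCoreOf red
  where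
  correct : ∀ {n} (G : Graph n) →
    Halts (setup ⨾ sweep ⨾ writeCore) (initial (encode G))
      (eval ((5 ∷ 3 ∷ []) ⊞ (sweepCost ⊞ (8 ∷ 11 ∷ 14 ∷ 3 ∷ []))) n)
      λ s → ∃ λ D → Outputs s (encode (core G D)) × Reduced {G = G} D 0
  correct {n} G = within
    (≤-reflexive (sym (trans (eval-⊞ (5 ∷ 3 ∷ []) (sweepCost ⊞ (8 ∷ 11 ∷ 14 ∷ 3 ∷ [])) n)
                             (cong (eval (5 ∷ 3 ∷ []) n +_) (eval-⊞ sweepCost (8 ∷ 11 ∷ 14 ∷ 3 ∷ []) n)))))
    (setup-correct G ⨟ λ (R , M) → sweep-correct R M ⨟ λ (R′ , D , M′ , red) →
      weaken (writeCore-correct M′ R′ refl) λ out → D , out , red)
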